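{- Let $\lambda$ be an infinite cardinal with $\lambda = \lambda^{<\lambda}$. If $\mathfrak{p}_\lambda = \lambda^+$, then $\mathfrak{t}_\lambda = \lambda^+$.
   Context: $\lambda$ is an infinite cardinal with $\lambda^{<\lambda}=\lambda$, so $\lambda$ is regular. For $A,B\subseteq\lambda$, $A\subseteq^* B$ means $|A\setminus B|<\lambda$. A family $\mathcal{F}\subseteq[\lambda]^\lambda$ has the strong intersection property if $|\bigcap\mathcal{F}'|=\lambda$ for every $\mathcal{F}'\subseteq\mathcal{F}$ with $0<|\mathcal{F}'|<\lambda$. A set $A$ is a pseudointersection of $\mathcal{F}$ if $A\subseteq^* F$ for all $F\in\mathcal{F}$. $\mathfrak{p}_\lambda$ is the least cardinality of a family $\mathcal{F}\subseteq[\lambda]^\lambda$ with the strong intersection property that has no pseudointersection of size $\lambda$. A tower in $\lambda$ is a family $\mathcal{T}\subseteq[\lambda]^\lambda$ that is well ordered by $\supseteq^*$, has the strong intersection property, and has no pseudointersection of size $\lambda$; $\mathfrak{t}_\lambda$ is the least cardinality of a tower in $\lambda$. -}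

module Defs where

open import Level using (Level; suc; _⊔_)
open import Data.Bool.Base using (Bool; T)
open import Data.Nat.Base using (ℕ)
open import Data.Product.Base using (Σ-syntax; ∃-syntax; _×_)
open import Data.Refinement.Base using (Refinement-syntax; Refinement; value)
open import Function.Bundles using (_↣_; _↔_)
open import Induction.WellFounded using (WellFounded)
open import Relation.Binary.Core using (Rel)
open import Relation.Binary.Structures using (IsStrictTotalOrder; IsTotalOrder)
import Relation.Binary.Construct.NonStrictToStrict as ToStrict
open import Relation.Binary.PropositionalEquality.Core using (_≡_)
open import Relation.Nullary.Negation.Core using (¬_)
open import Relation.Unary using (Pred; _∖_; Satisfiable)

private
  variable
    a b ℓ : Level

-- These definitions are meant to be read classically, in the presence of
-- ExcludedMiddle and function extensionality.  The library's
-- ExcludedMiddle decides every type, not just propositions, and so also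
-- provides choice functions; it also makes every predicate Bool-valued,
-- so that Subset A below is the full power set of A.

-- Cardinality comparison: _↔_ is |A| = |B|, _↣_ is |A| ≤ |B|.

_≺_ : Set a → Set b → Set (a ⊔ b)
A ≺ B = (A ↣ B) × ¬ (B ↣ A)

infix 4 _≺_

-- A cardinal is an initial ordinal.  Ordinals are given as well-ordered
-- types rather than as particular sets, so a cardinal is determined only
-- up to isomorphism.

record Cardinal ℓ : Set (suc ℓ) where
  field
    Carrier            : Set ℓ
    _<_                : Rel Carrier ℓ
    isStrictTotalOrder : IsStrictTotalOrder _≡_ _<_
    wellFounded        : WellFounded _<_

  Below : Carrier → Set ℓ
  Below α = [ β ∈ Carrier ∣ β < α ]

  field
    initial : ∀ α → Below α ≺ Carrier

open Cardinal public using (Carrier)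

Infinite : Cardinal ℓ → Set ℓ
Infinite κ = ℕ ↣ Carrier κ

-- κ^{<κ} is the cardinality of the set of functions from some ordinal
-- α < κ to κ.

_^<_ : (κ μ : Cardinal ℓ) → Set ℓ
κ ^< μ = Σ[ α ∈ Carrier μ ] (Cardinal.Below μ α → Carrier κ)

_IsSuccessorOf_ : Cardinal ℓ → Cardinal ℓ → Set (suc ℓ)
_IsSuccessorOf_ {ℓ} κ⁺ κ =
  (Carrier κ ≺ Carrier κ⁺) ×
  ((μ : Cardinal ℓ) → Carrier κ ≺ Carrier μ → Carrier κ⁺ ↣ Carrier μ)

Subset : Set a → Set a
Subset A = A → Bool

_∈_ : {A : Set a} → A → Subset A → Set
x ∈ X = T (X x)

_⊆_ : {A : Set a} → Subset A → Subset A → Set a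
X ⊆ Y = ∀ x → x ∈ X → x ∈ Y

infix 4 _∈_ _⊆_

-- The elements of a subset as a type.  The membership proof is
-- irrelevant, so the cardinality of this type is that of the subset.

∣_∣ₚ : {A : Set a} → Pred A b → Set (a ⊔ b)
∣_∣ₚ {A = A} P = [ x ∈ A ∣ P x ]

∣_∣ : {A : Set a} → Subset A → Set a
∣ X ∣ = ∣ (_∈ X) ∣ₚ

module Combinatorics (κ : Cardinal ℓ) where

  private
    K : Set ℓ
    K = Carrier κ

  Family : Set ℓ
  Family = Subset (Subset K)

  _⊆*_ _⊇*_ : Subset K → Subset K → Set ℓ
  A ⊆* B = ∣ (_∈ A) ∖ (_∈ B) ∣ₚ ≺ K
  A ⊇* B = B ⊆* A

  infix 4 _⊆*_ _⊇*_

  -- ℱ ⊆ [κ]^κ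
  OfFullSize : Family → Set ℓ
  OfFullSize ℱ = ∀ X → X ∈ ℱ → ∣ X ∣ ↔ K

  ⋂ : Family → Pred K ℓ
  ⋂ ℱ x = ∀ X → X ∈ ℱ → x ∈ X

  StrongIntersectionProperty : Family → Set ℓ
  StrongIntersectionProperty ℱ =
    ∀ 𝒢 → 𝒢 ⊆ ℱ → Satisfiable (_∈ 𝒢) → ∣ 𝒢 ∣ ≺ K → ∣ ⋂ 𝒢 ∣ₚ ↔ K

  _IsPseudointersectionOf_ : Subset K → Family → Set ℓ
  A IsPseudointersectionOf ℱ = ∀ X → X ∈ ℱ → A ⊆* X

  HasFullPseudointersection : Family → Set ℓ
  HasFullPseudointersection ℱ =
    ∃[ A ] (∣ A ∣ ↔ K) × (A IsPseudointersectionOf ℱ)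

  -- The order ⊇* on the members of ℱ, compared as sets by _≡_; in
  -- particular antisymmetry says that distinct members are not
  -- almost equal.
  WellOrderedBy⊇* : Family → Set ℓ
  WellOrderedBy⊇* ℱ = IsTotalOrder _≡_ _≤_ × WellFounded (ToStrict._<_ _≡_ _≤_)
    where
    _≤_ : Rel ∣ ℱ ∣ ℓ
    X ≤ Y = value X ⊇* value Y

  IsPFamily : Family → Set ℓ
  IsPFamily ℱ =
    OfFullSize ℱ × StrongIntersectionProperty ℱ × ¬ HasFullPseudointersection ℱ

  IsTower : Family → Set ℓ
  IsTower 𝒯 =
    OfFullSize 𝒯 × WellOrderedBy⊇* 𝒯 × StrongIntersectionProperty 𝒯 ×
    ¬ HasFullPseudointersection 𝒯

  _IsLeastCardinalityOf_ : Cardinal ℓ → (Family → Set ℓ) → Set ℓ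
  μ IsLeastCardinalityOf P =
    (∃[ ℱ ] P ℱ × (∣ ℱ ∣ ↔ Carrier μ)) × (∀ ℱ → P ℱ → Carrier μ ↣ ∣ ℱ ∣)

-- 𝔭 κ ≡ μ and 𝔱 κ ≡ μ are stated as relations, since the values exist
-- only when some family of the required kind does.

𝔭[_]≡_ : Cardinal ℓ → Cardinal ℓ → Set ℓ
𝔭[ κ ]≡ μ = μ IsLeastCardinalityOf IsPFamily
  where open Combinatorics κ

𝔱[_]≡_ : Cardinal ℓ → Cardinal ℓ → Set ℓ
𝔱[ κ ]≡ μ = μ IsLeastCardinalityOf IsTower
  where open Combinatorics κ

{-# OPTIONS --safe #-}
-- Every tower is a 𝔭-family, so only a tower of size κ⁺ is needed, and for that a
-- ⊇*-decreasing κ⁺-sequence without pseudointersection.  Let F α (α < κ⁺) be a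
-- family witnessing 𝔭 = κ⁺, and write each α as an increasing union of small sets
-- Reach i α (i < κ) so that β < α implies Reach i β ⊆ Reach i α for large i.  Let
-- k α i be the least y ≥ i lying in F ξ for all ξ in Reach i α; then k α increases
-- with α modulo bounded sets.  If some g is eventually exceeded by no k α, then g
-- serves to diagonalize the family at every α at once.  Otherwise the k α form a
-- scale, and no unbounded set is almost contained, for every α, in a set with gaps
-- longer than k α.  Such sets are given by the points closed under k α if κ is
-- uncountable, and by recursion on α if κ = ω.
-- κ^{<κ} = κ enters through König's argument, which makes κ regular.
module Submission where

open import Defs
open import Axiom.ExcludedMiddle using (ExcludedMiddle)
open import Axiom.Extensionality.Propositional using (Extensionality)
open import Data.Bool.Base using (Bool; true; false)
open import Data.Bool.Properties using (T?)
open import Data.Empty using (⊥-elim-irr)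
open import Data.Irrelevant using ([_])
import Data.Nat.Base as ℕ
import Data.Nat.Properties as ℕ
open import Data.Nat.Base using (ℕ; zero; suc)
open import Data.Product.Base using (∃; _×_; _,_; proj₁; proj₂)
open import Data.Refinement.Base using (value; _,_; refine)
open import Data.Sum.Base as Sum using (_⊎_; inj₁; inj₂)
open import Function.Base using (_∘_; id)
open import Function.Bundles using (_↔_; _↣_; mk↣; mk↔ₛ′; module Injection; module Inverse)
open import Function.Construct.Composition using (_↣-∘_)
open import Function.Properties.Inverse using (↔⇒↣; ↔-sym)
open import Induction.WellFounded
  using (WellFounded; WfRec; module All; module FixPoint; module Subrelation)
open import Level using (Level; Lift; lift; lower)
open import Relation.Binary.Core using (Rel)
import Relation.Binary.Construct.On as On
open import Relation.Binary.Construct.Closure.ReflexiveTransitive as Star using (Star; ε; _◅_)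
open import Relation.Binary.Definitions using (Trichotomous; tri<; tri≈; tri>)
open import Relation.Binary.Structures using (IsStrictTotalOrder)
open import Relation.Binary.PropositionalEquality.Core
  using (_≡_; _≢_; refl; sym; trans; cong; subst)
open import Relation.Binary.PropositionalEquality.Properties using (isEquivalence)
open import Relation.Nullary.Decidable.Core
  using (Dec; yes; no; ⌊_⌋; toWitness; fromWitness; decidable-stable; recompute)
open import Relation.Nullary.Negation.Core using (¬_; contradiction)

private
  variable
    a b r : Level

-- Maps given by relations, and subtypes.

graph⇒↣ : {A : Set a} {B : Set b} (R : A → B → Set r) →
          (∀ x → ∃ (R x)) → (∀ {x x′ y} → R x y → R x′ y → x ≡ x′) → A ↣ B
graph⇒↣ R total inj = mk↣ {to = proj₁ ∘ total} λ {x} {x′} eq →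
  inj (proj₂ (total x)) (subst (R x′) (sym eq) (proj₂ (total x′)))

graph⇒↔ : {A : Set a} {B : Set b} (R : A → B → Set r) →
          (∀ x → ∃ (R x)) → (∀ y → ∃ λ x → R x y) →
          (∀ {x y y′} → R x y → R x y′ → y ≡ y′) →
          (∀ {x x′ y} → R x y → R x′ y → x ≡ x′) → A ↔ B
graph⇒↔ R total onto fun inj = mk↔ₛ′ (proj₁ ∘ total) (proj₁ ∘ onto)
  (λ y → fun (proj₂ (total _)) (proj₂ (onto y)))
  (λ x → inj (proj₂ (onto _)) (proj₂ (total x)))

value-injective : {A : Set a} {P : A → Set b} {x y : ∣ P ∣ₚ} → value x ≡ value y → x ≡ y
value-injective refl = refl

value-↣ : {A : Set a} {P : A → Set b} → ∣ P ∣ₚ ↣ A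
value-↣ = mk↣ value-injective

subtype-↣ : {A : Set a} {P : A → Set b} {Q : A → Set r} →
            (∀ {x} → P x → Q x) → ∣ P ∣ₚ ↣ ∣ Q ∣ₚ
subtype-↣ {P = P} {Q} P⇒Q = mk↣ {to = f} λ {x} {y} eq →
  value-injective {x = x} {y} (cong value {f x} {f y} eq)
  where
  f : ∣ P ∣ₚ → ∣ Q ∣ₚ
  f = refine P⇒Q

∈-value : {A : Set a} {X : Subset A} (x : ∣ X ∣) → value x ∈ X
∈-value {X = X} (x , [ p ]) = recompute (T? (X x)) p

-- Choice by recursion along a well-founded relation.

module _ {ℓ} (ext : Extensionality ℓ ℓ) {W P : Set ℓ} {_<_ : Rel W ℓ}
         (wf : WellFounded _<_) where

  abstract
    -- Each value is picked by `next` from the earlier ones. Extensionality gives the unfolding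
    -- equation of the recursion, so that the property obtained speaks of the values of `c`
    -- themselves.
    wf-choice : (Q : ∀ w → (∀ y → y < w → P) → P → Set ℓ) → (∀ w ih → ∃ (Q w ih)) →
                ∃ λ (c : W → P) → ∀ w → Q w (λ y _ → c y) (c w)
    wf-choice Q next = c , λ w →
      subst (Q w (λ y _ → c y)) (sym unfold-wfRec) (proj₂ (next w (λ y _ → c y)))
      where
      f : ∀ w → WfRec _<_ (λ _ → P) w → P
      f w ih = proj₁ (next w λ y y<w → ih y<w)

      open FixPoint wf (λ _ → P) f
        (λ w eq → cong (λ ih → proj₁ (next w ih)) (ext λ y → ext λ y<w → eq y<w))

      c : W → P
      c = All.wfRec wf ℓ (λ _ → P) f

-- Classical reasoning and the Cantor-Schröder-Bernstein theorem.

module Classical {ℓ} (em : ExcludedMiddle ℓ) where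

  abstract
    dne : {P : Set ℓ} → ¬ ¬ P → P
    dne = decidable-stable em

  ¬∀⇒∃¬ : {A : Set ℓ} {P : A → Set ℓ} → ¬ (∀ x → P x) → ∃ λ x → ¬ P x
  ¬∀⇒∃¬ ¬∀ = dne λ ¬∃ → ¬∀ λ x → dne λ ¬px → ¬∃ (x , ¬px)

  ∈-valueₚ : {A : Set ℓ} {P : A → Set ℓ} (x : ∣ P ∣ₚ) → P (value x)
  ∈-valueₚ (x , [ p ]) = recompute em p

  subset : {A : Set ℓ} → (A → Set ℓ) → Subset A
  subset P x = ⌊ em {P x} ⌋

  ∈-subset⁺ : {A : Set ℓ} {P : A → Set ℓ} {x : A} → P x → x ∈ subset P
  ∈-subset⁺ = fromWitness

  ∈-subset⁻ : {A : Set ℓ} {P : A → Set ℓ} {x : A} → x ∈ subset P → P x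
  ∈-subset⁻ = toWitness

  module _ {A B : Set ℓ} (f : A ↣ B) (g : B ↣ A) where
    private
      module f = Injection f
      module g = Injection g

      -- The elements of A whose chain of preimages under g and f ends in A.
      data Stops : A → Set ℓ where
        here  : ∀ {x} → ¬ (∃ λ y → g.to y ≡ x) → Stops x
        there : ∀ {x} → Stops x → Stops (g.to (f.to x))

      Graph : A → B → Set ℓ
      Graph x y = (Stops x × f.to x ≡ y) ⊎ (¬ Stops x × g.to y ≡ x)

      total : ∀ x → ∃ (Graph x)
      total x with em {Stops x}
      ... | yes s = f.to x , inj₁ (s , refl)
      ... | no ¬s = let y , eq = dne (¬s ∘ here) in y , inj₂ (¬s , eq)

      stops⁻ : ∀ {x} → Stops x → ∀ y → g.to y ≡ x → ∃ λ x′ → Stops x′ × f.to x′ ≡ y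
      stops⁻ (here ¬im)    y eq = contradiction (y , eq) ¬im
      stops⁻ (there {x} s) y eq = x , s , sym (g.injective eq)

      onto : ∀ y → ∃ λ x → Graph x y
      onto y with em {Stops (g.to y)}
      ... | yes s = let x , s′ , eq = stops⁻ s y refl in x , inj₁ (s′ , eq)
      ... | no ¬s = g.to y , inj₂ (¬s , refl)

      functional : ∀ {x y y′} → Graph x y → Graph x y′ → y ≡ y′
      functional (inj₁ (_ , p))  (inj₁ (_ , q))  = trans (sym p) q
      functional (inj₁ (s , _))  (inj₂ (¬s , _)) = contradiction s ¬s
      functional (inj₂ (¬s , _)) (inj₁ (s , _))  = contradiction s ¬s
      functional (inj₂ (_ , p))  (inj₂ (_ , q))  = g.injective (trans p (sym q))

      injective : ∀ {x x′ y} → Graph x y → Graph x′ y → x ≡ x′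
      injective (inj₁ (_ , p))     (inj₁ (_ , q))     = f.injective (trans p (sym q))
      injective (inj₁ (s , refl))  (inj₂ (¬s , refl)) = contradiction (there s) ¬s
      injective (inj₂ (¬s , refl)) (inj₁ (s , refl))  = contradiction (there s) ¬s
      injective (inj₂ (_ , p))     (inj₂ (_ , q))     = trans (sym p) q

    cantor-schröder-bernstein : A ↔ B
    cantor-schröder-bernstein = graph⇒↔ Graph total onto functional injective

-- The well-order of a cardinal, and comparability.

module Order {ℓ} (em : ExcludedMiddle ℓ) (κ : Cardinal ℓ) where

  open Cardinal κ public using (_<_; isStrictTotalOrder; wellFounded; Below; initial)
  open IsStrictTotalOrder isStrictTotalOrder public
    using (compare; _<?_) renaming (trans to <-trans)
  open IsStrictTotalOrder isStrictTotalOrder using (irrefl)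
  open Classical em

  private
    K : Set ℓ
    K = Carrier κ

  infix 4 _≤_

  _≤_ : K → K → Set ℓ
  x ≤ y = ¬ (y < x)

  <-irrefl : ∀ {x} → ¬ (x < x)
  <-irrefl = irrefl refl

  <⇒≤ : ∀ {x y} → x < y → x ≤ y
  <⇒≤ p q = <-irrefl (<-trans p q)

  ≤-refl : ∀ {x} → x ≤ x
  ≤-refl = <-irrefl

  ≤-<-trans : ∀ {x y z} → x ≤ y → y < z → x < z
  ≤-<-trans {x} {y} x≤y y<z with compare x y
  ... | tri< x<y _ _  = <-trans x<y y<z
  ... | tri≈ _ refl _ = y<z
  ... | tri> _ _ y<x  = contradiction y<x x≤y

  <-≤-trans : ∀ {x y z} → x < y → y ≤ z → x < z
  <-≤-trans {x} {y} {z} x<y y≤z with compare y z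
  ... | tri< y<z _ _  = <-trans x<y y<z
  ... | tri≈ _ refl _ = x<y
  ... | tri> _ _ z<y  = contradiction z<y y≤z

  ≤-trans : ∀ {x y z} → x ≤ y → y ≤ z → x ≤ z
  ≤-trans x≤y y≤z z<x = y≤z (<-≤-trans z<x x≤y)

  ≤-antisym : ∀ {x y} → x ≤ y → y ≤ x → x ≡ y
  ≤-antisym {x} {y} x≤y y≤x with compare x y
  ... | tri< x<y _ _ = contradiction x<y y≤x
  ... | tri≈ _ eq _  = eq
  ... | tri> _ _ y<x = contradiction y<x x≤y

  ≤-total : ∀ x y → x ≤ y ⊎ y ≤ x
  ≤-total x y with y <? x
  ... | yes y<x = inj₂ (<⇒≤ y<x)
  ... | no  y≮x = inj₁ y≮x

  upper-bound : ∀ x y → ∃ λ z → x ≤ z × y ≤ z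
  upper-bound x y with ≤-total x y
  ... | inj₁ x≤y = y , x≤y , ≤-refl
  ... | inj₂ y≤x = x , ≤-refl , y≤x

  value-< : ∀ {y} (x : Below y) → value x < y
  value-< {y} (x , [ x<y ]) = recompute (x <? y) x<y

  abstract
    least : (P : K → Set ℓ) → ∃ P → ∃ λ x → P x × (∀ y → P y → x ≤ y)
    least P (x , px) = dne λ ¬least → All.wfRec wellFounded ℓ (λ x → ¬ P x)
      (λ x ih px → ¬least (x , px , λ y py y<x → ih y<x py)) x px

  distinct⇒↣ : {S : Set ℓ} (c : K → S) → (∀ x (y : Below x) → c (value y) ≢ c x) → K ↣ S
  distinct⇒↣ c distinct = mk↣ injective
    where
    injective : ∀ {x y} → c x ≡ c y → x ≡ y
    injective {x} {y} eq with compare x y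
    ... | tri< x<y _ _ = contradiction eq (distinct y (x , [ x<y ]))
    ... | tri≈ _ x≡y _ = x≡y
    ... | tri> _ _ y<x = contradiction (sym eq) (distinct x (y , [ y<x ]))

  abstract
    -- Recursion on κ picks an element of `S` different from all earlier ones. It can get stuck at w
    -- only if the elements picked before w exhaust `S`, and then sending each one to a place where
    -- it was picked embeds `S` in `Below w`.
    comparison : Extensionality ℓ ℓ → (S : Set ℓ) → (K ↣ S) ⊎ (∃ λ y → S ↣ Below y)
    comparison ext S with em {∃ λ y → S ↣ Below y}
    ... | yes below = inj₂ below
    ... | no ¬below = let c , c-fresh = wf-choice ext wellFounded Fresh fresh in
                      inj₁ (distinct⇒↣ c c-fresh)
      where
      Fresh : ∀ w → (∀ y → y < w → S) → S → Set ℓ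
      Fresh w ih s = (y : Below w) → ih (value y) (value-< y) ≢ s

      fresh : ∀ w ih → ∃ (Fresh w ih)
      fresh w ih = dne λ ¬fresh → ¬below (w , graph⇒↣ (λ s y → ih (value y) (value-< y) ≡ s)
        (λ s → dne λ ¬hit → ¬fresh (s , λ y eq → ¬hit (y , eq)))
        (λ p q → trans (sym p) q))

  -- An initial ordinal below κ is a cardinal in its own right; this lets the minimality of a
  -- successor cardinal be applied to it.
  segment : ∀ β → (∀ γ → γ < β → ¬ (Below β ↣ Below γ)) → Cardinal ℓ
  segment β least-size = record
    { Carrier            = Below β
    ; _<_                = λ x y → value x < value y
    ; isStrictTotalOrder = record
      { isStrictPartialOrder = record
        { isEquivalence = isEquivalence
        ; irrefl        = λ { refl → <-irrefl }
        ; trans         = <-trans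
        ; <-resp-≈      = (λ { refl → id }) , (λ { refl → id })
        }
      ; compare = compare′
      }
    ; wellFounded = On.wellFounded value wellFounded
    ; initial     = λ γ → value-↣ , λ β↣γ →
        least-size (value γ) (value-< γ) (graph⇒↣ (λ x y → value (value x) ≡ value y)
          (λ { (x , [ p ]) → (value x , [ p ]) , refl })
          (λ {x} {x′} p q → value-injective {x = x} {x′} (value-injective (trans p (sym q))))
            ↣-∘ β↣γ)
    }
    where
    compare′ : Trichotomous _≡_ (λ (x y : Below β) → value x < value y)
    compare′ x y with compare (value x) (value y)
    ... | tri< lt ¬eq ¬gt = tri< lt (¬eq ∘ cong value) ¬gt
    ... | tri≈ ¬lt eq ¬gt = tri≈ ¬lt (value-injective eq) ¬gt
    ... | tri> ¬lt ¬eq gt = tri> ¬lt (¬eq ∘ cong value) gt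

-- König's argument and the regularity of κ.

module Regularity {ℓ} (em : ExcludedMiddle ℓ) (ext : Extensionality ℓ ℓ) (κ : Cardinal ℓ)
                  (κ-infinite : Infinite κ) (κ^<κ↔κ : (κ ^< κ) ↔ Carrier κ) where

  open Classical em
  open Order em κ
  open Combinatorics κ

  private
    K : Set ℓ
    K = Carrier κ

  -- Only the second half of `S ≺ K`; comparability supplies the first half in `small⇒≺`.
  Small : ∀ {s} → Set s → Set _
  Small S = ¬ (K ↣ S)

  small-↣ : {A : Set a} {B : Set b} → A ↣ B → Small B → Small A
  small-↣ A↣B small K↣A = small (A↣B ↣-∘ K↣A)

  small⇒↣below : {S : Set ℓ} → Small S → ∃ λ y → S ↣ Below y
  small⇒↣below {S} small with comparison ext S
  ... | inj₁ K↣S   = contradiction K↣S small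
  ... | inj₂ below = below

  small⇒≺ : {S : Set ℓ} → Small S → S ≺ K
  small⇒≺ small = value-↣ ↣-∘ proj₂ (small⇒↣below small) , small

  below-small : ∀ y → Small (Below y)
  below-small y = proj₂ (initial y)

  module _ {M : Set ℓ} (M-small : Small M) where
    private
      y : K
      y = proj₁ (small⇒↣below M-small)

      module j = Injection (proj₂ (small⇒↣below M-small))

    -- `_^<_` only knows functions on initial segments, so M is embedded in one. The values off the
    -- image do not depend on `F`, and `F` is recovered by restriction.
    extend : (M → K) → Below y → K
    extend F z with em {∃ λ m → j.to m ≡ z}
    ... | yes (m , _) = F m
    ... | no  _       = value z

    extend-j : ∀ F m → extend F (j.to m) ≡ F m
    extend-j F m with em {∃ λ m′ → j.to m′ ≡ j.to m}
    ... | yes (m′ , eq) = cong F (j.injective eq)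
    ... | no  ¬im       = contradiction (m , refl) ¬im

    code : (M → K) → K
    code F = Inverse.to κ^<κ↔κ (y , extend F)

    code-injective : ∀ {F G} → code F ≡ code G → ∀ m → F m ≡ G m
    code-injective {F} {G} eq m =
      trans (sym (extend-j F m)) (trans (cong (λ h → h (j.to m)) (,-injective eq′)) (extend-j G m))
      where
      eq′ : (y , extend F) ≡ (y , extend G)
      eq′ = Injection.injective (↔⇒↣ κ^<κ↔κ) eq

      ,-injective : {g h : Below y → K} → _≡_ {A = κ ^< κ} (y , g) (y , h) → g ≡ h
      ,-injective refl = refl

    decode : K → M → K
    decode x with em {∃ λ F → code F ≡ x}
    ... | yes (F , _) = F
    ... | no  _       = λ _ → x

    decode-code : ∀ F m → decode (code F) m ≡ F m
    decode-code F m with em {∃ λ G → code G ≡ code F}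
    ... | yes (G , eq) = code-injective eq m
    ... | no  ¬im      = contradiction (F , refl) ¬im

    -- As in König's theorem, a code of a function that at each m avoids the
    -- values at m of the functions coded in B m cannot lie in any B m.
    abstract
      könig : (B : M → K → Set ℓ) → (∀ m → Small ∣ B m ∣ₚ) → ∃ λ x → ∀ m → ¬ B m x
      könig B B-small = code F , λ m b → proj₂ (avoid m) (code F , [ b ]) (decode-code F m)
        where
        avoid : ∀ m → ∃ λ z → (x : ∣ B m ∣ₚ) → decode (value x) m ≢ z
        avoid m = dne λ ¬avoid → B-small m (graph⇒↣ (λ z x → decode (value x) m ≡ z)
          (λ z → dne λ ¬hit → ¬avoid (z , λ x eq → ¬hit (x , eq)))
          (λ p q → trans (sym p) q))

        F : M → K
        F m = proj₁ (avoid m)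

    -- An injection of `K` into the union would pull the `P m` back to small sets that cover `K`,
    -- against `könig`.
    small-⋃ : {S : Set ℓ} (P : M → S → Set ℓ) → (∀ m → Small ∣ P m ∣ₚ) →
              Small ∣ (λ s → ∃ λ m → P m s) ∣ₚ
    small-⋃ P P-small K↣⋃ =
      let x , x∉ = könig (λ m x → P m (value (g.to x))) λ m → small-↣
                     (graph⇒↣ (λ x s → value (g.to (value x)) ≡ value s)
                       (λ { (x , [ p ]) → (value (g.to x) , [ p ]) , refl })
                       (λ {x} {x′} p q → value-injective {x = x} {x′}
                         (g.injective (value-injective (trans p (sym q))))))
                     (P-small m)
          m , p  = ∈-valueₚ (g.to x)
      in x∉ m p
      where module g = Injection K↣⋃

  pigeonhole : (f : ℕ → Bool) → ¬ (∀ {m n} → f m ≡ f n → m ≡ n)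
  pigeonhole f inj with f 0 in eq₀ | f 1 in eq₁ | f 2 in eq₂
  ... | true  | true  | _     = contradiction (inj (trans eq₀ (sym eq₁))) λ ()
  ... | false | false | _     = contradiction (inj (trans eq₀ (sym eq₁))) λ ()
  ... | true  | false | true  = contradiction (inj (trans eq₀ (sym eq₂))) λ ()
  ... | true  | false | false = contradiction (inj (trans eq₁ (sym eq₂))) λ ()
  ... | false | true  | true  = contradiction (inj (trans eq₁ (sym eq₂))) λ ()
  ... | false | true  | false = contradiction (inj (trans eq₀ (sym eq₂))) λ ()

  bool-small : Small (Lift ℓ Bool)
  bool-small K↣Bool = pigeonhole (λ n → lower (Injection.to ℕ↣Bool n))
    λ eq → Injection.injective ℕ↣Bool (cong lift eq)
    where ℕ↣Bool = K↣Bool ↣-∘ κ-infinite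

  small-∪ : {S : Set ℓ} (P Q : S → Set ℓ) → Small ∣ P ∣ₚ → Small ∣ Q ∣ₚ →
            Small ∣ (λ s → P s ⊎ Q s) ∣ₚ
  small-∪ P Q P-small Q-small = small-↣
    (subtype-↣ λ { (inj₁ p) → lift true , p ; (inj₂ q) → lift false , q })
    (small-⋃ bool-small P∪Q λ { (lift true) → P-small ; (lift false) → Q-small })
    where
    P∪Q : Lift ℓ Bool → _ → Set ℓ
    P∪Q (lift true)  = P
    P∪Q (lift false) = Q

  singleton-small : {S : Set ℓ} (s : S) → Small ∣ (_≡ s) ∣ₚ
  singleton-small s = small-↣ (mk↣ {to = λ _ → lift true} λ {x} {y} _ →
    value-injective {x = x} {y} (trans (equal x) (sym (equal y)))) bool-small
    where
    equal : (x : ∣ (_≡ s) ∣ₚ) → value x ≡ s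
    equal = ∈-valueₚ

  abstract
    -- If y were the greatest element, `K` would be the union of the small sets `Below y` and {y}.
    above : ∀ y → ∃ λ z → y < z
    above y = dne λ ¬above → small-∪ (_< y) (_≡ y) (below-small y) (singleton-small y)
      (graph⇒↣ (λ x z → x ≡ value z)
        (λ x → (x , [ ≤⇒<⊎≡ (λ y<x → ¬above (x , y<x)) ]) , refl)
        (λ p q → trans p (sym q)))
      where
      ≤⇒<⊎≡ : ∀ {x} → x ≤ y → x < y ⊎ x ≡ y
      ≤⇒<⊎≡ {x} x≤y with compare x y
      ... | tri< x<y _ _ = inj₁ x<y
      ... | tri≈ _ eq _  = inj₂ eq
      ... | tri> _ _ y<x = contradiction y<x x≤y

  abstract
    -- This is regularity: the sets of points up to `f m` are small, so `könig` finds a point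
    -- outside all of them.
    small-bounded : {M : Set ℓ} → Small M → (f : M → K) → ∃ λ y → ∀ m → f m < y
    small-bounded M-small f =
      let y , ¬≤ = könig M-small (λ m x → x ≤ f m) λ m →
                     let z , fm<z = above (f m)
                     in small-↣ (subtype-↣ λ x≤fm → ≤-<-trans x≤fm fm<z) (below-small z)
      in y , λ m → dne (¬≤ m)

  -- Eventual and unbounded properties; small sets as bounded sets.

  Eventually : ∀ {p} → (K → Set p) → Set _
  Eventually P = ∃ λ y → ∀ x → y ≤ x → P x

  Unbounded : ∀ {p} → (K → Set p) → Set _
  Unbounded P = ∀ y → ∃ λ x → y ≤ x × P x

  eventually-above : ∀ y → Eventually (y <_)
  eventually-above y = let z , y<z = above y in z , λ x → <-≤-trans y<z

  eventually-all : ∀ {p} {M : Set ℓ} {P : M → K → Set p} → Small M →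
                   (∀ m → Eventually (P m)) → Eventually (λ x → ∀ m → P m x)
  eventually-all M-small ev =
    let y , <y = small-bounded M-small (proj₁ ∘ ev)
    in y , λ x y≤x m → proj₂ (ev m) x (≤-trans (<⇒≤ (<y m)) y≤x)

  eventually-map : ∀ {p q} {P : K → Set p} {Q : K → Set q} →
                   (∀ x → P x → Q x) → Eventually P → Eventually Q
  eventually-map f (y , p) = y , λ x y≤x → f x (p x y≤x)

  eventually-map₂ : ∀ {p q r} {P : K → Set p} {Q : K → Set q} {R : K → Set r} →
                    (∀ x → P x → Q x → R x) → Eventually P → Eventually Q → Eventually R
  eventually-map₂ f (y , p) (z , q) =
    let w , y≤w , z≤w = upper-bound y z
    in w , λ x w≤x → f x (p x (≤-trans y≤w w≤x)) (q x (≤-trans z≤w w≤x))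

  unbounded-map : ∀ {p q r} {P : K → Set p} {Q : K → Set q} {R : K → Set r} →
                  (∀ x → P x → Q x → R x) → Eventually P → Unbounded Q → Unbounded R
  unbounded-map f (y , p) unb z =
    let w , y≤w , z≤w = upper-bound y z
        x , w≤x , q   = unb w
    in x , ≤-trans z≤w w≤x , f x (p x (≤-trans y≤w w≤x)) q

  ¬unbounded⇒eventually : {P : K → Set ℓ} → ¬ Unbounded (λ x → ¬ P x) → Eventually P
  ¬unbounded⇒eventually ¬unb =
    let y , ¬beyond = ¬∀⇒∃¬ ¬unb in y , λ x y≤x → dne λ ¬p → ¬beyond (x , y≤x , ¬p)

  -- If the image of v stayed below y, then `S`, and with it `K`, would embed in the small set
  -- `Below y`.
  full⇒cofinal : {S : Set ℓ} (v : S ↣ K) → K ↣ S → ∀ y → ∃ λ s → y ≤ Injection.to v s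
  full⇒cofinal v K↣S y = dne λ ¬cofinal → small-↣
    (mk↣ {to = λ s → Injection.to v s , [ dne (λ y≤ → ¬cofinal (s , y≤)) ]}
      λ eq → Injection.injective v (cong value eq)) (below-small y) K↣S

  -- A small `S` would have bounded image by regularity, so `K` embeds in `S` and
  -- Cantor-Schröder-Bernstein applies.
  cofinal⇒full : {S : Set ℓ} (v : S ↣ K) → (∀ y → ∃ λ s → y ≤ Injection.to v s) → S ↔ K
  cofinal⇒full {S} v cofinal = cantor-schröder-bernstein v (dne λ S-small →
    let y , <y  = small-bounded S-small (Injection.to v)
        s , y≤s = cofinal y
    in y≤s (<y s))

  unbounded⇒full : {X : Subset K} → Unbounded (_∈ X) → ∣ X ∣ ↔ K
  unbounded⇒full unb = cofinal⇒full value-↣ λ y →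
    let x , y≤x , x∈X = unb y in (x , [ x∈X ]) , y≤x

  full⇒unbounded : {X : Subset K} → ∣ X ∣ ↔ K → Unbounded (_∈ X)
  full⇒unbounded full y =
    let x , y≤x = full⇒cofinal value-↣ (↔⇒↣ (↔-sym full)) y in value x , y≤x , ∈-value x

  -- Since subsets of `K` are small exactly when bounded, this is `_⊆*_` in a form that composes by
  -- taking the larger of two thresholds.
  _≼_ : Subset K → Subset K → Set ℓ
  X ≼ Y = Eventually λ x → x ∈ X → x ∈ Y

  ≼-refl : ∀ {X Y} → X ≡ Y → X ≼ Y
  ≼-refl refl = proj₁ (above x₀) , λ _ _ → id
    where x₀ = Injection.to κ-infinite 0

  ≼-trans : ∀ {X Y Z} → X ≼ Y → Y ≼ Z → X ≼ Z
  ≼-trans = eventually-map₂ λ _ X⊆Y Y⊆Z → Y⊆Z ∘ X⊆Y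

  ≼⇒⊆* : ∀ {X Y} → X ≼ Y → X ⊆* Y
  ≼⇒⊆* {X} {Y} (y , X⊆Y) = small⇒≺ λ K↣X∖Y →
    let x , y≤x = full⇒cofinal value-↣ K↣X∖Y y in difference x y≤x
    where
    difference : (x : ∣ (λ x → x ∈ X × ¬ (x ∈ Y)) ∣ₚ) → ¬ (y ≤ value x)
    difference (x , [ p ]) y≤x = ⊥-elim-irr (proj₂ p (X⊆Y x y≤x (proj₁ p)))

  ⊆*⇒≼ : ∀ {X Y} → X ⊆* Y → X ≼ Y
  ⊆*⇒≼ {X} {Y} (_ , small) =
    let y , <y = small-bounded small value
    in y , λ x y≤x x∈X → decidable-stable (T? (Y x)) λ x∉Y → y≤x (<y (x , [ x∈X , x∉Y ]))

-- The successor cardinal κ⁺.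

module Successor {ℓ} (em : ExcludedMiddle ℓ) (ext : Extensionality ℓ ℓ) (κ κ⁺ : Cardinal ℓ)
                 (κ-infinite : Infinite κ) (κ^<κ↔κ : (κ ^< κ) ↔ Carrier κ)
                 (κ⁺-successor : κ⁺ IsSuccessorOf κ) where

  open Classical em
  open Regularity em ext κ κ-infinite κ^<κ↔κ
  open Order em κ⁺
  open Combinatorics κ

  private
    K K⁺ : Set ℓ
    K  = Carrier κ
    K⁺ = Carrier κ⁺

  abstract
    -- Otherwise the least β whose segment receives `Below α` is an initial ordinal larger than κ.
    -- Minimality of κ⁺ then embeds κ⁺ in `Below β`, although κ⁺ is initial.
    below-↣ : ∀ α → Below α ↣ K
    below-↣ α = dne λ ¬α↣K →
      let β , α↣β , β-least = least (λ β → Below α ↣ Below β) (α , mk↣ {to = id} id)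
          ¬β↣K              = λ β↣K → ¬α↣K (β↣K ↣-∘ α↣β)
      in proj₂ (initial β) (proj₂ κ⁺-successor
           (segment β λ γ γ<β β↣γ → β-least γ (β↣γ ↣-∘ α↣β) γ<β)
           (dne (¬β↣K ∘ proj₁ ∘ small⇒≺) , ¬β↣K))

  -- A pair as a function on a two-element set, so that `code` provides a pairing function on κ.
  choose : K → K → Lift ℓ Bool → K
  choose x y (lift true)  = x
  choose x y (lift false) = y

  abstract
    -- If there were no bound, every α would lie below some `f m`. The pair of m and the position of
    -- α below `f m` would then code κ⁺ injectively in κ.
    bounded : {M : Set ℓ} → M ↣ K → (f : M → K⁺) → ∃ λ α → ∀ m → f m ≤ α
    bounded {M} M↣K f = dne λ ¬bounded → proj₂ (proj₁ κ⁺-successor) (graph⇒↣ Coded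
      (λ α → let m , ¬≤ = ¬∀⇒∃¬ λ ∀≤ → ¬bounded (α , ∀≤) in _ , m , (α , [ dne ¬≤ ]) , refl , refl)
      coded-injective)
      where
      Coded : K⁺ → K → Set ℓ
      Coded α z = ∃ λ m → ∃ λ (b : Below (f m)) → value b ≡ α ×
        code bool-small (choose (Injection.to M↣K m) (Injection.to (below-↣ (f m)) b)) ≡ z

      coded-injective : ∀ {α α′ z} → Coded α z → Coded α′ z → α ≡ α′
      coded-injective (m , b , refl , p) (m′ , b′ , refl , q)
        with eq ← code-injective bool-small (trans p (sym q))
        with refl ← Injection.injective M↣K (eq (lift true))
        = cong value (Injection.injective (below-↣ (f m)) (eq (lift false)))

  -- Towers from decreasing κ⁺-sequences.

  module Tower (T : K⁺ → Subset K) (T-unbounded : ∀ α → Unbounded (_∈ T α))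
               (T-decreasing : ∀ {α β} → β < α → T α ≼ T β)
               (T-no-pseudointersection : ∀ A → Unbounded (_∈ A) → ¬ (∀ α → A ≼ T α)) where

    -- Antisymmetry of ⊇* forces one representative of each class of almost
    -- equal sets: the one of least index.
    Leader : Subset K → K⁺ → Set ℓ
    Leader X α = X ≡ T α × (∀ β → β < α → ¬ (T β ≼ T α))

    𝒯 : Family
    𝒯 = subset (∃ ∘ Leader)

    leader : ∀ {X} → X ∈ 𝒯 → ∃ (Leader X)
    leader = ∈-subset⁻ {P = ∃ ∘ Leader}

    index : ∣ 𝒯 ∣ → K⁺
    index X = proj₁ (leader (∈-value X))

    value≡T-index : ∀ X → value X ≡ T (index X)
    value≡T-index X = proj₁ (proj₂ (leader (∈-value X)))

    index-injective : ∀ {X Y} → index X ≡ index Y → X ≡ Y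
    index-injective {X} {Y} eq =
      value-injective (trans (value≡T-index X) (trans (cong T eq) (sym (value≡T-index Y))))

    T-antitone : ∀ {α β} → β ≤ α → T α ≼ T β
    T-antitone {α} {β} β≤α with compare β α
    ... | tri< β<α _ _ = T-decreasing β<α
    ... | tri≈ _ eq _  = ≼-refl (cong T (sym eq))
    ... | tri> _ _ α<β = contradiction α<β β≤α

    index-≤⇒⊇* : ∀ X Y → index X ≤ index Y → value X ⊇* value Y
    index-≤⇒⊇* X Y le = ≼⇒⊆* (≼-trans (≼-refl (value≡T-index Y))
      (≼-trans (T-antitone le) (≼-refl (sym (value≡T-index X)))))

    -- If `Y` had the smaller index, `X` would not be a leader. With the converse above, this
    -- transports the well-order of κ⁺ to `𝒯` along `index`.
    ⊇*⇒index-≤ : ∀ X Y → value X ⊇* value Y → index X ≤ index Y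
    ⊇*⇒index-≤ X Y Y⊆*X lt = proj₂ (proj₂ (leader (∈-value X))) (index Y) lt
      (≼-trans (≼-refl (sym (value≡T-index Y)))
        (≼-trans (⊆*⇒≼ Y⊆*X) (≼-refl (value≡T-index X))))

    full : OfFullSize 𝒯
    full X X∈𝒯 with leader X∈𝒯
    ... | α , refl , _ = unbounded⇒full (T-unbounded α)

    wellOrdered : WellOrderedBy⊇* 𝒯
    wellOrdered = record
      { isPartialOrder = record
        { isPreorder = record
          { isEquivalence = isEquivalence
          ; reflexive     = λ { {X} refl → index-≤⇒⊇* X X ≤-refl }
          ; trans         = λ {X} {Y} {Z} X≤Y Y≤Z → index-≤⇒⊇* X Z
              (≤-trans (⊇*⇒index-≤ X Y X≤Y) (⊇*⇒index-≤ Y Z Y≤Z))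
          }
        ; antisym = λ {X} {Y} → antisym X Y
        }
      ; total = λ X Y → Sum.map (index-≤⇒⊇* X Y) (index-≤⇒⊇* Y X)
                          (≤-total (index X) (index Y))
      } , Subrelation.wellFounded
            (λ {X} {Y} (X≤Y , X≢Y) → dne λ Y≤X → X≢Y (antisym X Y X≤Y (index-≤⇒⊇* Y X Y≤X)))
            (On.wellFounded index wellFounded)
      where
      antisym : ∀ X Y → value X ⊇* value Y → value Y ⊇* value X → X ≡ Y
      antisym X Y X≤Y Y≤X =
        index-injective (≤-antisym (⊇*⇒index-≤ X Y X≤Y) (⊇*⇒index-≤ Y X Y≤X))

    -- The indices of fewer than κ members have a bound α in κ⁺. By regularity a final part of `T α`
    -- lies in all these members at once.
    strongIntersection : StrongIntersectionProperty 𝒯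
    strongIntersection 𝒢 𝒢⊆𝒯 _ (𝒢↣K , 𝒢-small) = cofinal⇒full value-↣ λ y →
      let x , y≤x , x∈⋂ = unbounded-map
            (λ x ∈T⇒ x∈T X X∈𝒢 → ∈T⇒ (X , [ X∈𝒢 ]) x∈T)
            (eventually-all 𝒢-small below-α) (T-unbounded α) y
      in (x , [ x∈⋂ ]) , y≤x
      where
      member : ∣ 𝒢 ∣ → ∣ 𝒯 ∣
      member X = value X , [ 𝒢⊆𝒯 (value X) (∈-value X) ]

      α : K⁺
      α = proj₁ (bounded 𝒢↣K (index ∘ member))

      below-α : ∀ (X : ∣ 𝒢 ∣) → T α ≼ value X
      below-α X = ≼-trans (T-antitone (proj₂ (bounded 𝒢↣K (index ∘ member)) X))
                          (≼-refl (sym (value≡T-index (member X))))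

    no-pseudointersection : ¬ HasFullPseudointersection 𝒯
    no-pseudointersection (A , A-full , A⊆*) =
      T-no-pseudointersection A (full⇒unbounded A-full) λ α →
        -- The least such β indexes a leader, so `T β` belongs to `𝒯` and passes the almost
        -- inclusion on to `T α`.
        let β , β≼α , β-least = least (λ β → T β ≼ T α) (α , ≼-refl refl)
        in ≼-trans (⊆*⇒≼ (A⊆* (T β) (∈-subset⁺ {P = ∃ ∘ Leader} (β , refl , λ γ γ<β γ≼β →
             β-least γ (≼-trans γ≼β β≼α) γ<β)))) β≼α

    isTower : IsTower 𝒯
    isTower = full , wellOrdered , strongIntersection , no-pseudointersection

    𝒯↣κ⁺ : ∣ 𝒯 ∣ ↣ K⁺
    𝒯↣κ⁺ = mk↣ index-injective

  private
    module κ = Order em κ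

  open κ using () renaming (_<_ to _<ₖ_; _≤_ to _≤ₖ_)

  IsUnboundedDecreasing : (K⁺ → Subset K) → Set ℓ
  IsUnboundedDecreasing S = (∀ α → Unbounded (_∈ S α)) × (∀ {α β} → β < α → S α ≼ S β)

  NoPseudointersection : (K⁺ → Subset K) → Set ℓ
  NoPseudointersection S = ∀ A → Unbounded (_∈ A) → ¬ (∀ α → A ≼ S α)

  -- The sets `Reach i α` and the functions `k α`.

  module FromPFamily (ℱ : Family) (ℱ-isPFamily : IsPFamily ℱ) (ℱ↔κ⁺ : ∣ ℱ ∣ ↔ K⁺) where

    private
      module ℱ↔κ⁺ = Inverse ℱ↔κ⁺

      module ι α = Injection (below-↣ α)

    F : K⁺ → Subset K
    F α = value (ℱ↔κ⁺.from α)

    F-no-pseudointersection : NoPseudointersection F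
    F-no-pseudointersection A A-unbounded A≼F =
      proj₂ (proj₂ ℱ-isPFamily) (A , unbounded⇒full A-unbounded , λ X X∈ℱ →
        ≼⇒⊆* (≼-trans (A≼F (ℱ↔κ⁺.to (X , [ X∈ℱ ])))
                      (≼-refl (cong value (ℱ↔κ⁺.strictlyInverseʳ (X , [ X∈ℱ ]))))))

    Step : K → K⁺ → K⁺ → Set ℓ
    Step i α β = ∃ λ (b : Below α) → value b ≡ β × ι.to α b <ₖ i

    -- For fixed α, the sets Reach i α form an increasing chain of subsets of
    -- size < κ with union {β : β ≤ α}.  Unlike the sets enumerated before i by
    -- arbitrary bijections, they increase with α for all large i.
    Reach : K → K⁺ → K⁺ → Set ℓ
    Reach i = Star (Step i)

    reach-monotone : ∀ {i j α ξ} → i ≤ₖ j → Reach i α ξ → Reach j α ξ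
    reach-monotone i≤j = Star.map λ { (b , eq , lt) → b , eq , κ.<-≤-trans lt i≤j }

    abstract
      -- Once i exceeds the position of β in the enumeration of `Below α`, a single step leads from
      -- α to β, and every path from β can be continued from there.
      reach-increasing : ∀ {α β} → β < α → Eventually (λ i → ∀ ξ → Reach i β ξ → Reach i α ξ)
      reach-increasing {α} {β} β<α = eventually-map (λ i lt ξ s → ((β , [ β<α ]) , refl , lt) ◅ s)
        (eventually-above (ι.to α (β , [ β<α ])))

    -- By induction on α: apart from α itself, the set is the union of the small sets reached from
    -- the fewer than κ many predecessors enumerated before i.
    reach-small : ∀ i α → Small ∣ Reach i α ∣ₚ
    reach-small i = All.wfRec wellFounded ℓ (λ α → Small ∣ Reach i α ∣ₚ) λ α ih →
      small-↣ (subtype-↣ λ { ε → inj₁ refl ; ((b , refl , lt) ◅ s) → inj₂ ((b , [ lt ]) , s) })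
        (small-∪ (_≡ α) _ (singleton-small α)
          (small-⋃ (predecessors-small α) (λ m → Reach i (value (value m)))
            λ m → ih (value-< (value m))))
      where
      predecessors-small : ∀ α → Small ∣ (λ b → ι.to α b <ₖ i) ∣ₚ
      predecessors-small α = small-↣
        (graph⇒↣ (λ b y → ι.to α (value b) ≡ value y)
          (λ { (b , [ lt ]) → (ι.to α b , [ lt ]) , refl })
          (λ {x} {x′} p q → value-injective {x = x} {x′} (ι.injective α (trans p (sym q)))))
        (below-small i)

    Meets : K⁺ → K → K → Set ℓ
    Meets α i y = i ≤ₖ y × (∀ ξ → Reach i α ξ → y ∈ F ξ)

    -- The strong intersection property, applied to the small subfamily of all `F ξ` with ξ in
    -- `Reach i α`, gives a common part of full size, hence one with points past i.
    meets : ∀ α i → ∃ (Meets α i)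
    meets α i =
      let x , i≤x = full⇒cofinal value-↣ (↔⇒↣ (↔-sym ⋂-full)) i
      in value x , i≤x , λ ξ s → ∈-valueₚ x (F ξ) (∈-subset⁺ {P = In𝒢} (ξ , s , refl))
      where
      In𝒢 : Subset K → Set ℓ
      In𝒢 X = ∃ λ ξ → Reach i α ξ × X ≡ F ξ

      𝒢 : Family
      𝒢 = subset In𝒢

      𝒢⊆ℱ : 𝒢 ⊆ ℱ
      𝒢⊆ℱ X X∈𝒢 with ∈-subset⁻ {P = In𝒢} X∈𝒢
      ... | ξ , _ , refl = ∈-value (ℱ↔κ⁺.from ξ)

      𝒢-small : Small ∣ 𝒢 ∣
      𝒢-small = small-↣
        (graph⇒↣ (λ X ξ → value X ≡ F (value ξ))
          (λ X → let ξ , s , eq = ∈-subset⁻ {P = In𝒢} (∈-value X) in (ξ , [ s ]) , eq)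
          (λ p q → value-injective (trans p (sym q))))
        (reach-small i α)

      ⋂-full : ∣ ⋂ 𝒢 ∣ₚ ↔ K
      ⋂-full = proj₁ (proj₂ ℱ-isPFamily) 𝒢 𝒢⊆ℱ
        (F α , ∈-subset⁺ {P = In𝒢} (α , ε , refl)) (small⇒≺ 𝒢-small)

    k : K⁺ → K → K
    k α i = proj₁ (κ.least (Meets α i) (meets α i))

    k-meets : ∀ α i → Meets α i (k α i)
    k-meets α i = proj₁ (proj₂ (κ.least (Meets α i) (meets α i)))

    k-least : ∀ α i y → Meets α i y → k α i ≤ₖ y
    k-least α i = proj₂ (proj₂ (κ.least (Meets α i) (meets α i)))

    -- A larger index only adds constraints, so `k α j` is a candidate in the minimum that defines
    -- `k α i`.
    k-monotone : ∀ α {i j} → i ≤ₖ j → k α i ≤ₖ k α j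
    k-monotone α {i} {j} i≤j = let j≤k , k∈ = k-meets α j in
      k-least α i (k α j) (κ.≤-trans i≤j j≤k , λ ξ s → k∈ ξ (reach-monotone i≤j s))

    abstract
      k-increasing : ∀ {α β} → β < α → Eventually (λ i → k β i ≤ₖ k α i)
      k-increasing {α} {β} β<α = eventually-map
        (λ i β⊆α → let i≤k , k∈ = k-meets α i in k-least β i (k α i) (i≤k , λ ξ s → k∈ ξ (β⊆α ξ s)))
        (reach-increasing β<α)

    -- If no k α eventually exceeds g, the family is diagonalized along the slowly
    -- growing inverse of g: Reached i y says that i is at most that inverse at y.
    module NotDominating (g : K → K) (k≤g : ∀ α → Unbounded (λ i → k α i ≤ₖ g i)) where

      Reached : K → K → Set ℓ
      Reached i y = ∀ j → j <ₖ i → g j <ₖ y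

      reached : ∀ i → Eventually (Reached i)
      reached i = eventually-map (λ y <y j j<i → <y (j , [ j<i ]))
        (eventually-all (below-small i) λ j → eventually-above (g (value j)))

      InDiagonal : K⁺ → K → Set ℓ
      InDiagonal α y = ∀ i → Reached i y → ∀ ξ → Reach i α ξ → y ∈ F ξ

      diagonal : K⁺ → Subset K
      diagonal α = subset (InDiagonal α)

      diagonal≼F : ∀ α → diagonal α ≼ F α
      diagonal≼F α = eventually-map
        (λ y r y∈ → ∈-subset⁻ {P = InDiagonal α} y∈ i r α ε) (reached i)
        -- Any index serves, because α lies in every `Reach i α`.
        where i = Injection.to κ-infinite 0

      -- Whenever `k α i ≤ₖ g i`, the point `k α i` is in the diagonal set: an index j reached there
      -- is at most i, since otherwise `g i <ₖ k α i`. Hence `Reach j α` is contained in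
      -- `Reach i α`.
      diagonal-unbounded : ∀ α → Unbounded (_∈ diagonal α)
      diagonal-unbounded α z =
        let i , z≤i , k≤gi = k≤g α z
            i≤k , k∈       = k-meets α i
        in k α i , κ.≤-trans z≤i i≤k , ∈-subset⁺ {P = InDiagonal α} λ j r ξ s →
             k∈ ξ (reach-monotone (λ i<j → k≤gi (r i i<j)) s)

      diagonal-decreasing : ∀ {α β} → β < α → diagonal α ≼ diagonal β
      diagonal-decreasing {α} {β} β<α = eventually-map member (reached i₀)
        where
        i₀ : K
        i₀ = proj₁ (reach-increasing β<α)

        β⊆α : ∀ i → i₀ ≤ₖ i → ∀ ξ → Reach i β ξ → Reach i α ξ
        β⊆α = proj₂ (reach-increasing β<α)

        member : ∀ y → Reached i₀ y → y ∈ diagonal α → y ∈ diagonal β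
        member y r₀ y∈α = ∈-subset⁺ {P = InDiagonal β} λ i r ξ s → case i r ξ s (κ.≤-total i₀ i)
          where
          case : ∀ i → Reached i y → ∀ ξ → Reach i β ξ → i₀ ≤ₖ i ⊎ i ≤ₖ i₀ → y ∈ F ξ
          case i r ξ s (inj₁ i₀≤i) = ∈-subset⁻ {P = InDiagonal α} y∈α i r ξ (β⊆α i i₀≤i ξ s)
          -- For small i the inclusion in `Reach i α` may fail, but y is large enough for `i₀` to be
          -- reached, and `Reach i β` is contained in `Reach i₀ α`.
          case i r ξ s (inj₂ i≤i₀) = ∈-subset⁻ {P = InDiagonal α} y∈α i₀ r₀ ξ
            (β⊆α i₀ κ.≤-refl ξ (reach-monotone i≤i₀ s))

      diagonal-no-pseudointersection : NoPseudointersection diagonal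
      diagonal-no-pseudointersection A A-unbounded A≼ =
        F-no-pseudointersection A A-unbounded λ α → ≼-trans (A≼ α) (diagonal≼F α)

    -- Sparse sets when the `k α` form a scale.

    Sparse : K⁺ → Subset K → Set ℓ
    Sparse α X = ∀ {x y} → x ∈ X → y ∈ X → x <ₖ y → k α x <ₖ y

    module Dominating (g<k : ∀ (g : K → K) → ∃ λ α → Eventually (λ i → g i <ₖ k α i)) where

      -- The second element past i of a pseudointersection would dominate every k α.
      sparse⇒no-pseudointersection : (S : K⁺ → Subset K) → (∀ α → Sparse α (S α)) →
                                     NoPseudointersection S
      sparse⇒no-pseudointersection S sparse A A-unbounded A≼S =
        let α , z , gz<k = g<k g
            w , A⊆S      = A≼S α
            i , z≤i , w≤i = κ.upper-bound z w
            x∈S = A⊆S (x i) (κ.≤-trans w≤i (i≤x i)) (x∈A i)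
            g∈S = A⊆S (g i) (κ.≤-trans w≤i (κ.≤-trans (i≤x i) (κ.<⇒≤ (x<g i)))) (g∈A i)
        in κ.<⇒≤ (gz<k i z≤i)
             (κ.≤-<-trans (k-monotone α (i≤x i)) (sparse α x∈S g∈S (x<g i)))
        where
        x g : K → K
        x i = proj₁ (A-unbounded i)
        g i = proj₁ (A-unbounded (proj₁ (above (x i))))

        i≤x : ∀ i → i ≤ₖ x i
        i≤x i = proj₁ (proj₂ (A-unbounded i))

        x∈A : ∀ i → x i ∈ A
        x∈A i = proj₂ (proj₂ (A-unbounded i))

        x<g : ∀ i → x i <ₖ g i
        x<g i = κ.<-≤-trans (proj₂ (above (x i))) (proj₁ (proj₂ (A-unbounded _)))

        g∈A : ∀ i → g i ∈ A
        g∈A i = proj₂ (proj₂ (A-unbounded _))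

      -- Uncountable κ: points closed under `k α`.

      module Uncountable (ℕ-small : Small (Lift ℓ ℕ)) where

        Closed : K⁺ → K → Set ℓ
        Closed α δ = ∀ i → i <ₖ δ → k α i <ₖ δ

        closed : K⁺ → Subset K
        closed α = subset (Closed α)

        closed-sparse : ∀ α → Sparse α (closed α)
        closed-sparse α _ y∈ x<y = ∈-subset⁻ {P = Closed α} y∈ _ x<y

        closed-decreasing : ∀ {α β} → β < α → closed α ≼ closed β
        closed-decreasing {α} {β} β<α = eventually-map member (eventually-above i₀)
          where
          i₀ : K
          i₀ = proj₁ (k-increasing β<α)

          kβ≤kα : ∀ i → i₀ ≤ₖ i → k β i ≤ₖ k α i
          kβ≤kα = proj₂ (k-increasing β<α)

          kβ<δ : ∀ δ → i₀ <ₖ δ → Closed α δ → ∀ i → i <ₖ δ → i₀ ≤ₖ i ⊎ i ≤ₖ i₀ → k β i <ₖ δ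
          kβ<δ δ i₀<δ cl i i<δ (inj₁ i₀≤i) = κ.≤-<-trans (kβ≤kα i i₀≤i) (cl i i<δ)
          -- Below `i₀` monotonicity of `k β` reduces the bound to the one at `i₀`, which is itself
          -- below δ.
          kβ<δ δ i₀<δ cl i i<δ (inj₂ i≤i₀) =
            κ.≤-<-trans (κ.≤-trans (k-monotone β i≤i₀) (kβ≤kα i₀ κ.≤-refl)) (cl i₀ i₀<δ)

          member : ∀ δ → i₀ <ₖ δ → δ ∈ closed α → δ ∈ closed β
          member δ i₀<δ δ∈ = ∈-subset⁺ {P = Closed β} λ i i<δ →
            kβ<δ δ i₀<δ (∈-subset⁻ {P = Closed α} δ∈) i i<δ (κ.≤-total i₀ i)

        -- The supremum of the sequence z, then each time a point beyond `k α` of the last, exists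
        -- by regularity since ℕ is small. It is closed because every smaller i is at most some
        -- term.
        closed-unbounded : ∀ α → Unbounded (_∈ closed α)
        closed-unbounded α z =
          let δ , c<δ , δ-least = κ.least (λ δ → ∀ n → c (lower n) <ₖ δ)
                                    (small-bounded ℕ-small (c ∘ lower))
          in δ , κ.<⇒≤ (c<δ (lift 0)) , ∈-subset⁺ {P = Closed α} λ i i<δ →
               let lift n , i≤cn = ¬∀⇒∃¬ λ c<i → δ-least i c<i i<δ
               in κ.<-trans (κ.≤-<-trans (k-monotone α i≤cn) (proj₂ (above (k α (c n)))))
                            (c<δ (lift (suc n)))
          where
          c : ℕ → K
          c zero    = z
          c (suc n) = proj₁ (above (k α (c n)))

      -- The sets closed under k α may be empty here, but a decreasing sequence of
      -- countable length has a pseudointersection, which can be taken sparse.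
      module Countable (κ↔ℕ : K ↔ Lift ℓ ℕ) where

        private
          module e = Inverse κ↔ℕ

        range : (ℕ → K) → Subset K
        range s = subset λ x → ∃ λ n → s n ≡ x

        range⁺ : ∀ s n → s n ∈ range s
        range⁺ s n = ∈-subset⁺ {P = λ x → ∃ λ n → s n ≡ x} (n , refl)

        range⁻ : ∀ s {x} → x ∈ range s → ∃ λ n → s n ≡ x
        range⁻ s = ∈-subset⁻ {P = λ x → ∃ λ n → s n ≡ x}

        -- The first bound makes the range unbounded, since `e.from ∘ lift` enumerates κ; the second
        -- makes the range sparse.
        Grows : K⁺ → (ℕ → K) → Set ℓ
        Grows α s = ∀ n → e.from (lift n) ≤ₖ s n × k α (s n) <ₖ s (suc n)

        grows⇒unbounded : ∀ {α s} → Grows α s → Unbounded (_∈ range s)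
        grows⇒unbounded {s = s} grows y =
          let n = lower (e.to y)
          in s n , subst (_≤ₖ s n) (e.strictlyInverseʳ y) (proj₁ (grows n)) , range⁺ s n

        grows⇒monotone : ∀ {α s} → Grows α s → ∀ {m n} → m ℕ.≤′ n → s m ≤ₖ s n
        grows⇒monotone grows ℕ.≤′-refl = κ.≤-refl
        grows⇒monotone {α} grows (ℕ.≤′-step {n} m≤n) = κ.≤-trans (grows⇒monotone grows m≤n)
          (κ.<⇒≤ (κ.≤-<-trans (proj₁ (k-meets α _)) (proj₂ (grows n))))

        grows⇒<-reflecting : ∀ {α s} → Grows α s → ∀ {m n} → s m <ₖ s n → m ℕ.< n
        grows⇒<-reflecting grows lt =
          ℕ.≰⇒> λ n≤m → grows⇒monotone grows (ℕ.≤⇒≤′ n≤m) lt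

        grows⇒sparse : ∀ {α s} → Grows α s → Sparse α (range s)
        grows⇒sparse {α} {s} grows {x} {y} x∈ y∈ = sparse (range⁻ s {x} x∈) (range⁻ s {y} y∈)
          where
          sparse : ∀ {x y} → (∃ λ m → s m ≡ x) → (∃ λ n → s n ≡ y) → x <ₖ y → k α x <ₖ y
          sparse (m , refl) (n , refl) sm<sn = κ.<-≤-trans (proj₂ (grows m))
            (grows⇒monotone grows (ℕ.≤⇒≤′ (grows⇒<-reflecting grows sm<sn)))

        -- Diagonalizing a decreasing sequence of countable length.

        module _ (α : K⁺) (S : Below α → Subset K) (S-unbounded : ∀ b → Unbounded (_∈ S b))
                 (S-decreasing : ∀ b c → value c < value b → S b ≼ S c) where

          rank : Below α → ℕ
          rank b = lower (e.to (ι.to α b))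

          rank-injective : ∀ {b c} → rank b ≡ rank c → b ≡ c
          rank-injective eq = ι.injective α (Injection.injective (↔⇒↣ κ↔ℕ) (cong lift eq))

          Common : ℕ → K → Set ℓ
          Common n x = ∀ b → rank b ℕ.< n → x ∈ S b

          common-suc : ∀ {n x} → Common n x → (∀ b → rank b ≡ n → x ∈ S b) → Common (suc n) x
          common-suc {n} com new b lt with rank b ℕ.≟ n
          ... | yes eq = new b eq
          ... | no neq = com b (ℕ.≤∧≢⇒< (ℕ.≤-pred lt) neq)

          lower-bound : ∀ b c → ∃ λ d → S d ≼ S b × S d ≼ S c
          lower-bound b c with compare (value b) (value c)
          ... | tri< b<c _ _ = c , S-decreasing c b b<c , ≼-refl refl
          ... | tri≈ _ eq _  = b , ≼-refl refl , ≼-refl (cong S (value-injective eq))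
          ... | tri> _ _ c<b = b , ≼-refl refl , S-decreasing b c c<b

          -- Finitely many sets have rank below n and `≼` compares any two, so one of them is almost
          -- contained in their intersection. The second alternative is the case of no such set.
          common-large : ∀ n → (∃ λ b → Eventually (λ x → x ∈ S b → Common n x)) ⊎ (∀ x → Common n x)
          common-large zero = inj₂ λ x b ()
          common-large (suc n) with em {∃ λ b → rank b ≡ n} | common-large n
          ... | no ¬b | inj₁ (c , ev) = inj₁ (c , eventually-map
                  (λ x com x∈ → common-suc (com x∈) λ b eq → contradiction (b , eq) ¬b) ev)
          ... | no ¬b | inj₂ com = inj₂ λ x → common-suc (com x) λ b eq → contradiction (b , eq) ¬b
          ... | yes (b , refl) | inj₁ (c , ev) =
                  let d , d≼b , d≼c = lower-bound b c
                  in inj₁ (d , eventually-map₂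
                       (λ x b∋x com x∈d → common-suc (com x∈d) λ b′ eq →
                         subst (λ b → x ∈ S b) (rank-injective (sym eq)) (b∋x x∈d))
                       d≼b (eventually-map₂ (λ x d⊆c com → com ∘ d⊆c) d≼c ev))
          ... | yes (b , refl) | inj₂ com = inj₁ (b , eventually-map
                  (λ x _ x∈ → common-suc (com x) λ b′ eq →
                    subst (λ b → x ∈ S b) (rank-injective (sym eq)) x∈) (≼-refl {S b} refl))

          common-unbounded : ∀ n → Unbounded (Common n)
          common-unbounded n with common-large n
          ... | inj₁ (b , ev) = unbounded-map (λ _ → id) ev (S-unbounded b)
          ... | inj₂ com      = λ y → y , κ.≤-refl , com y

          next : ∀ n y → ∃ λ x → y <ₖ x × e.from (lift n) ≤ₖ x × Common n x
          next n y =
            let z , y<z         = above y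
                w , z≤w , n≤w   = κ.upper-bound z (e.from (lift n))
                x , w≤x , com   = common-unbounded n w
            in x , κ.<-≤-trans y<z (κ.≤-trans z≤w w≤x) , κ.≤-trans n≤w w≤x , com

          diag : ℕ → K
          -- The second argument is arbitrary here: `next` itself keeps the value at or above
          -- `e.from (lift zero)`.
          diag zero    = proj₁ (next zero (e.from (lift zero)))
          diag (suc n) = proj₁ (next (suc n) (k α (diag n)))

          diag-common : ∀ n → e.from (lift n) ≤ₖ diag n × Common n (diag n)
          diag-common zero    = proj₂ (proj₂ (next zero (e.from (lift zero))))
          diag-common (suc n) = proj₂ (proj₂ (next (suc n) (k α (diag n))))

          diag-grows : Grows α diag
          diag-grows n = proj₁ (diag-common n) , proj₁ (proj₂ (next (suc n) (k α (diag n))))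

          -- A term beyond `diag (rank b)` has index greater than `rank b`, so it was chosen inside
          -- `S b`.
          diag-≼ : ∀ b → range diag ≼ S b
          diag-≼ b = eventually-map member (eventually-above (diag (rank b)))
            where
            late : ∀ {x} → diag (rank b) <ₖ x → (∃ λ n → diag n ≡ x) → x ∈ S b
            late lt (n , refl) = proj₂ (diag-common n) b (grows⇒<-reflecting diag-grows lt)

            member : ∀ x → diag (rank b) <ₖ x → x ∈ range diag → x ∈ S b
            member x lt x∈ = late lt (range⁻ diag {x} x∈)

        -- Recursion along κ⁺.

        ranges : ∀ α → (∀ β → β < α → ℕ → K) → Below α → Subset K
        ranges α ih b = range (ih (value b) (value-< b))

        Good : ∀ α → (∀ β → β < α → ℕ → K) → (ℕ → K) → Set ℓ
        Good α ih s = Grows α s × (∀ b → range s ≼ ranges α ih b)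

        Previous : ∀ α → (∀ β → β < α → ℕ → K) → Set ℓ
        Previous α ih = (∀ b → Unbounded (_∈ ranges α ih b)) ×
                        (∀ b c → value c < value b → ranges α ih b ≼ ranges α ih c)

        -- The recursion has to answer arbitrary earlier values, so goodness is conditional on
        -- `Previous`; where that fails, a dummy sequence is returned.
        good : ∀ α ih → ∃ λ s → Previous α ih → Good α ih s
        good α ih = by-cases em
          where
          by-cases : Dec (Previous α ih) → ∃ λ s → Previous α ih → Good α ih s
          by-cases (yes (unb , dec)) =
            diag α S unb dec , λ _ → diag-grows α S unb dec , diag-≼ α S unb dec
            where S = ranges α ih
          by-cases (no ¬previous) = e.from ∘ lift , λ previous → contradiction previous ¬previous

        -- Well-founded induction discharges the condition: `Previous` at α follows from goodness of
        -- the earlier sequences.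
        sequences : ∃ λ (s : K⁺ → ℕ → K) → ∀ α → Good α (λ β _ → s β) (s α)
        sequences = s , All.wfRec wellFounded ℓ (λ α → Good α (λ β _ → s β) (s α)) λ α ih →
          proj₂ chosen α
            ( (λ b → grows⇒unbounded {value b} {s (value b)} (proj₁ (ih (value-< b))))
            , (λ b c c<b → proj₂ (ih (value-< b)) (value c , [ c<b ])) )
          where
          chosen : ∃ λ (s : K⁺ → ℕ → K) → ∀ α → Previous α (λ β _ → s β) → Good α (λ β _ → s β) (s α)
          chosen = wf-choice ext wellFounded (λ α ih s → Previous α ih → Good α ih s) good

          s : K⁺ → ℕ → K
          s = proj₁ chosen

        sparse-sequence : ∃ λ S → IsUnboundedDecreasing S × (∀ α → Sparse α (S α))
        sparse-sequence = (λ α → range (s α)) ,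
          ( (λ α → grows⇒unbounded {α} {s α} (proj₁ (s-good α)))
          , (λ {α} {β} β<α → proj₂ (s-good α) (β , [ β<α ])) ) ,
          (λ α → grows⇒sparse {α} {s α} (proj₁ (s-good α)))
          where
          s : K⁺ → ℕ → K
          s = proj₁ sequences

          s-good : ∀ α → Good α (λ β _ → s β) (s α)
          s-good = proj₂ sequences

    -- The case distinction, and the cardinality of the tower.

    dominating : ¬ (∃ λ (g : K → K) → ∀ α → Unbounded (λ i → k α i ≤ₖ g i)) →
                 ∀ (g : K → K) → ∃ λ α → Eventually (λ i → g i <ₖ k α i)
    dominating ¬k≤g g = exceeds (¬∀⇒∃¬ λ k≤g → ¬k≤g (g , k≤g))
      where
      exceeds : (∃ λ α → ¬ Unbounded (λ i → k α i ≤ₖ g i)) →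
                ∃ λ α → Eventually (λ i → g i <ₖ k α i)
      exceeds (α , ¬unbounded) = α , ¬unbounded⇒eventually ¬unbounded

    decreasing-sequence : ∃ λ S → IsUnboundedDecreasing S × NoPseudointersection S
    decreasing-sequence = by-cases em em
      where
      by-cases : Dec (∃ λ (g : K → K) → ∀ α → Unbounded (λ i → k α i ≤ₖ g i)) →
                 Dec (K ↣ Lift ℓ ℕ) → ∃ λ S → IsUnboundedDecreasing S × NoPseudointersection S
      by-cases (yes (g , k≤g)) _ =
        diagonal , (diagonal-unbounded , diagonal-decreasing) , diagonal-no-pseudointersection
        where open NotDominating g k≤g
      by-cases (no ¬k≤g) (yes κ↣ℕ) =
        proj₁ sparse-sequence , proj₁ (proj₂ sparse-sequence) ,
        sparse⇒no-pseudointersection (proj₁ sparse-sequence) (proj₂ (proj₂ sparse-sequence))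
        where
        open Dominating (dominating ¬k≤g)
        open Countable (cantor-schröder-bernstein κ↣ℕ
          (mk↣ {to = Injection.to κ-infinite ∘ lower}
            (cong lift ∘ Injection.injective κ-infinite)))
      by-cases (no ¬k≤g) (no ℕ-small) =
        closed , (closed-unbounded , closed-decreasing) ,
        sparse⇒no-pseudointersection closed closed-sparse
        where
        open Dominating (dominating ¬k≤g)
        open Uncountable ℕ-small

mainTheorem1 : ∀ {ℓ} → ExcludedMiddle ℓ → Extensionality ℓ ℓ →
    (κ κ⁺ : Cardinal ℓ) → Infinite κ → (κ ^< κ) ↔ Carrier κ →
    κ⁺ IsSuccessorOf κ →
    𝔭[ κ ]≡ κ⁺ → 𝔱[ κ ]≡ κ⁺
mainTheorem1 em ext κ κ⁺ κ-infinite κ^<κ↔κ κ⁺-successor ((ℱ , ℱ-isPFamily , ℱ↔κ⁺) , 𝔭-least) =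
  -- The leaders are indexed injectively by κ⁺, which bounds the size of `𝒯` from above; as a
  -- 𝔭-family `𝒯` also has at least κ⁺ members.
  (𝒯 , isTower , cantor-schröder-bernstein 𝒯↣κ⁺ (𝔭-least 𝒯 (tower⇒pFamily 𝒯 isTower))) ,
  λ 𝒯 isTower → 𝔭-least 𝒯 (tower⇒pFamily 𝒯 isTower)
  where
  open Classical em
  open Combinatorics κ
  open Successor em ext κ κ⁺ κ-infinite κ^<κ↔κ κ⁺-successor
  open FromPFamily ℱ ℱ-isPFamily ℱ↔κ⁺

  tower⇒pFamily : ∀ 𝒯 → IsTower 𝒯 → IsPFamily 𝒯
  tower⇒pFamily _ (full , _ , sip , no-pseudointersection) = full , sip , no-pseudointersection

  S-decreasing = proj₁ (proj₂ decreasing-sequence)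

  open Tower (proj₁ decreasing-sequence) (proj₁ S-decreasing) (proj₂ S-decreasing)
             (proj₂ (proj₂ decreasing-sequence))
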